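{- For fixed $k\in\{1,\dots,n-1\}$, the number of intervals $[\sigma_k,w]_{\mathrm{wk}}$ (with $w\in\mathfrak{S}_n$, $\sigma_k\le_{\mathrm{wk}}w$) in the weak order on $\mathfrak{S}_n$ that are lattices is $n!/2$.
   Context: $\mathfrak{S}_n$ is the symmetric group with Coxeter generators $\sigma_1,\dots,\sigma_{n-1}$, where $\sigma_i$ is the transposition swapping $i$ and $i+1$. A reduced decomposition of $w$ is a word of minimal length in these generators with product $w$. (Right) weak order: $v\le_{\mathrm{wk}}w$ if some reduced decomposition of $v$ is a prefix of a reduced decomposition of $w$. $[v,w]_{\mathrm{wk}}=\{u: v\le_{\mathrm{wk}}u\le_{\mathrm{wk}}w\}$ for $v\le_{\mathrm{wk}}w$. -}

module Defs where

open import Data.Fin.Base using (Fin; suc; inject₁)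
open import Data.Fin.Permutation using (Permutation′; transpose; id; _∘ₚ_; _≈_)
open import Data.List.Base using (List; foldr; length)
open import Data.List.Relation.Binary.Prefix.Heterogeneous using (Prefix)
open import Data.Nat.Base using (ℕ; suc; _≤_)
open import Data.Product.Base using (_×_; ∃; ∃₂; proj₁)
open import Function.Base using (_on_)
open import Function.Bundles using (Inverse)
open import Level using (Level; 0ℓ; _⊔_)
open import Relation.Binary.Bundles using (Setoid)
open import Relation.Binary.Lattice.Structures using (IsLattice)
open import Relation.Binary.PropositionalEquality using (_≡_; setoid)
open import Relation.Unary using (Pred; _∈_; _≐_)
open import Relation.Unary.Properties using (≐-refl; ≐-sym; ≐-trans)

private
  variable
    m   : ℕ
    c ℓ : Level

-- The symmetric group 𝔖ₙ with n = suc m is 𝔖 m. Positions and generator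
-- indices are counted from 0, so that the n - 1 Coxeter generators are
-- indexed by Fin m.
𝔖 : ℕ → Set
𝔖 m = Permutation′ (suc m)

σ : Fin m → 𝔖 m
σ i = transpose (inject₁ i) (suc i)

Word : ℕ → Set
Word m = List (Fin m)

-- The product is taken with (u v)(x) = u (v x), whereas π ∘ₚ ρ applies π
-- first; hence the reversed arguments.
product : Word m → 𝔖 m
product = foldr (λ i u → u ∘ₚ σ i) id

IsReducedDecomposition : Word m → 𝔖 m → Set
IsReducedDecomposition {m} a w =
  product a ≈ w × (∀ (b : Word m) → product b ≈ w → length a ≤ length b)

infix 4 _≤wk_

_≤wk_ : 𝔖 m → 𝔖 m → Set
v ≤wk w = ∃₂ λ a b →
  IsReducedDecomposition a v × IsReducedDecomposition b w × Prefix _≡_ a b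

[_,_]wk : 𝔖 m → 𝔖 m → Pred (𝔖 m) 0ℓ
[ v , w ]wk u = v ≤wk u × u ≤wk w

IntervalIsLattice : 𝔖 m → 𝔖 m → Set
IntervalIsLattice v w =
  ∃₂ λ (_∨_ _∧_ : I → I → I) →
    IsLattice (_≈_ on proj₁) (_≤wk_ on proj₁) _∨_ _∧_
  where
  I : Set
  I = ∃ λ u → u ∈ [ v , w ]wk

record LatticeInterval (v : 𝔖 m) : Set where
  field
    top       : 𝔖 m
    v≤top     : v ≤wk top
    isLattice : IntervalIsLattice v top

  elements : Pred (𝔖 m) 0ℓ
  elements = [ v , top ]wk

-- Two intervals are identified when they are equal as subsets of 𝔖 m.
latticeIntervals : 𝔖 m → Setoid 0ℓ 0ℓ
latticeIntervals v = record
  { Carrier       = LatticeInterval v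
  ; _≈_           = λ I J → elements I ≐ elements J
  ; isEquivalence = record
    { refl  = ≐-refl
    ; sym   = ≐-sym
    ; trans = ≐-trans
    }
  }
  where open LatticeInterval

HasCardinality : Setoid c ℓ → ℕ → Set (c ⊔ ℓ)
HasCardinality S N = Inverse S (setoid (Fin N))

{-# OPTIONS --safe #-}
module Submission where

-- A permutation w is determined by its inversion set Inv w, the set of pairs
-- of values x < y with y placed before x. Passing from v to v σᵢ changes Inv v by
-- exactly one pair, so reduced words have length |Inv w|, and climbing
-- from v by ascents whose new inversion lies in Inv w shows that v ≤wk w
-- amounts to Inv v ⊆ Inv w.
-- The inversion sets are the relations inside < that are transitive with
-- transitive complement, and this property survives complementation and the
-- transitive closure of a union. Hence the weak order is a lattice, and so is
-- every interval [σₖ, w]. These intervals correspond to the w that invert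
-- k and k + 1, and w ↦ σₖ w exchanges those with the remaining permutations.

open import Data.Bool.Base using (if_then_else_)
open import Data.Fin.Base
  using (Fin; zero; suc; inject₁; fromℕ; fromℕ<; toℕ; punchIn; punchOut; combine; remQuot; _<_; _>_)
open import Data.Fin.Induction using (Acc; acc; >-wellFounded; <-weakInduction; >-weakInduction)
open import Data.Fin.Permutation
  using (Permutation′; permutation; transpose; id; flip; _⟨$⟩ʳ_; _⟨$⟩ˡ_; _∘ₚ_; _≈_; insert; remove;
         inverseˡ; inverseʳ; punchIn-permute; insert-punchIn; insert-remove; remove-insert)
import Data.Fin.Properties as Fin
open import Data.List.Base using ([]; _∷_; _++_; length)
import Data.List.Properties as List
open import Data.List.Relation.Binary.Pointwise using (Pointwise-≡⇒≡; ≡⇒Pointwise-≡)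
open import Data.List.Relation.Binary.Prefix.Heterogeneous
  using (toView; fromView) renaming (_++_ to _++ᵛ_)
open import Data.Nat.Base as ℕ using (ℕ; zero; suc; _+_; _*_; _!; _/_; z≤n; s≤s)
open import Data.Nat.DivMod using (m*n/n≡m)
import Data.Nat.Properties as ℕ
open import Algebra.Properties.CommutativeMonoid.Sum ℕ.+-0-commutativeMonoid
  using (sum; sum-cong-≗; sum-permute; ∑-distrib-+)
open import Data.Product.Base using (_×_; ∃; _,_; proj₁; proj₂)
open import Data.Sum.Base using (_⊎_; inj₁; inj₂; [_,_]′) renaming (map to map-⊎)
open import Data.Unit.Base using (tt)
open import Function.Base using (_∘_) renaming (id to idᶠ)
open import Function.Bundles using (Inverse)
import Function.Construct.Composition as Composition
open import Function.Definitions using (Injective)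
open import Level using (Level; 0ℓ)
open import Relation.Binary.Bundles using (Setoid)
open import Relation.Binary.Construct.Closure.Transitive as Plus using (TransClosure; [_]; _∷_)
import Relation.Binary.Construct.On as On
open import Relation.Binary.Construct.Union using (_∪_)
open import Relation.Binary.Core using (Rel; _⇒_)
open import Relation.Binary.Definitions
  using (tri<; tri≈; tri>; Transitive) renaming (Decidable to Decidable₂)
open import Relation.Binary.PropositionalEquality
open import Relation.Binary.Structures using (IsPartialOrder)
open import Relation.Nullary using (Dec; yes; no; does; ¬_; contradiction)
open import Relation.Nullary.Decidable using (_×-dec_; _⊎-dec_; ¬?; dec-true; dec-false; map′)
open import Relation.Unary using (Pred; Decidable; _∈_; _≐_)
open import Relation.Unary.Properties using (≐-refl)
open import Defs

private
  variable
    m n : ℕ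
    p : Level
    A B : Set p
    P Q : Pred (Fin n) p

-- Finite counting

indicator : Dec A → ℕ
indicator A? = if does A? then 1 else 0

indicator-mono : (A? : Dec A) (B? : Dec B) → (A → B) → indicator A? ℕ.≤ indicator B?
indicator-mono (no  _) _       _ = z≤n
indicator-mono (yes _) (yes _) _ = s≤s z≤n
indicator-mono (yes a) (no ¬b) f = contradiction (f a) ¬b

indicator-cong : (A? : Dec A) (B? : Dec B) → (A → B) → (B → A) → indicator A? ≡ indicator B?
indicator-cong A? B? f g = ℕ.≤-antisym (indicator-mono A? B? f) (indicator-mono B? A? g)

indicator-true : (A? : Dec A) → A → indicator A? ≡ 1
indicator-true (yes _) _ = refl
indicator-true (no ¬a) a = contradiction a ¬a

indicator-false : (A? : Dec A) → ¬ A → indicator A? ≡ 0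
indicator-false (yes a) ¬a = contradiction a ¬a
indicator-false (no _)  _  = refl

sum-mono-≤ : {f g : Fin n → ℕ} → (∀ i → f i ℕ.≤ g i) → sum f ℕ.≤ sum g
sum-mono-≤ {n = zero}  _   = z≤n
sum-mono-≤ {n = suc n} f≤g = ℕ.+-mono-≤ (f≤g zero) (sum-mono-≤ (f≤g ∘ suc))

sum-suc-at : {f g : Fin n → ℕ} (j : Fin n) → f j ≡ suc (g j) → (∀ i → i ≢ j → f i ≡ g i) →
             sum f ≡ suc (sum g)
sum-suc-at zero    eq rest = cong₂ _+_ eq (sum-cong-≗ λ i → rest (suc i) λ ())
sum-suc-at {g = g} (suc j) eq rest = trans
  (cong₂ _+_ (rest zero λ ()) (sum-suc-at j eq λ i i≢j → rest (suc i) (i≢j ∘ Fin.suc-injective)))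
  (ℕ.+-suc (g zero) _)

sum-mono-< : {f g : Fin n → ℕ} → (∀ i → f i ℕ.≤ g i) → (j : Fin n) → f j ℕ.< g j → sum f ℕ.< sum g
sum-mono-< f≤g zero    fj<gj = ℕ.+-mono-<-≤ fj<gj (sum-mono-≤ (f≤g ∘ suc))
sum-mono-< f≤g (suc j) fj<gj = ℕ.+-mono-≤-< (f≤g zero) (sum-mono-< (f≤g ∘ suc) j fj<gj)

count : Decidable P → ℕ
count P? = sum (indicator ∘ P?)

sum-const-1 : ∀ n → sum {n} (λ _ → 1) ≡ n
sum-const-1 zero    = refl
sum-const-1 (suc n) = cong suc (sum-const-1 n)

count-mono-< : (P? : Decidable P) (Q? : Decidable Q) → (∀ i → P i → Q i) →
               ∀ j → ¬ P j → Q j → count P? ℕ.< count Q?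
count-mono-< P? Q? P⊆Q j ¬Pj Qj = sum-mono-< (λ i → indicator-mono (P? i) (Q? i) (P⊆Q i)) j
  (subst₂ ℕ._<_ (sym (indicator-false (P? j) ¬Pj)) (sym (indicator-true (Q? j) Qj)) (s≤s z≤n))

count<n : (P? : Decidable {A = Fin n} P) → ∀ j → ¬ P j → count P? ℕ.< n
count<n {n = n} P? j ¬Pj = subst (count P? ℕ.<_) (sum-const-1 n)
  (count-mono-< P? (λ _ → yes tt) (λ _ _ → tt) j ¬Pj tt)

-- By recursion on `n`: `zero` takes index 0 if it satisfies `P`, and the later elements are shifted
-- accordingly. The source setoid compares first components only, so different proofs of `P i` give
-- the same element.
count-enumerates : ∀ {n} {P : Pred (Fin n) p} (P? : Decidable P) →
                   HasCardinality (On.setoid (setoid (Fin n)) (proj₁ {B = P})) (count P?)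
count-enumerates {n = zero} P? = record
  { to        = λ ()
  ; from      = λ ()
  ; to-cong   = λ { {()} }
  ; from-cong = λ { {()} }
  ; inverse   = (λ { {()} }) , (λ { {()} })
  }
count-enumerates {n = suc n} P? with P? zero | count-enumerates (P? ∘ suc)
... | yes P0 | e = record
  { to        = λ { (zero , _) → zero ; (suc i , Pi) → suc (E.to (i , Pi)) }
  ; from      = λ { zero → zero , P0 ; (suc j) → suc (proj₁ (E.from j)) , proj₂ (E.from j) }
  ; to-cong   = λ { {zero , _} {zero , _} _ → refl
                  ; {suc _ , _} {suc _ , _} eq → cong suc (E.to-cong (Fin.suc-injective eq)) }
  ; from-cong = λ { refl → refl }
  ; inverse   = (λ { {zero} {zero , _} _ → refl
                   ; {suc j} {suc i , _} eq → cong suc (E.inverseˡ (Fin.suc-injective eq)) })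
              , (λ { {zero , _} refl → refl
                   ; {suc i , _} refl → cong suc (E.inverseʳ refl) })
  }
  where module E = Inverse e
... | no ¬P0 | e = record
  { to        = λ { (zero , P0) → contradiction P0 ¬P0 ; (suc i , Pi) → E.to (i , Pi) }
  ; from      = λ j → suc (proj₁ (E.from j)) , proj₂ (E.from j)
  ; to-cong   = λ { {zero , P0} → contradiction P0 ¬P0
                  ; {suc _ , _} {suc _ , _} eq → E.to-cong (Fin.suc-injective eq) }
  ; from-cong = λ { refl → refl }
  ; inverse   = (λ { {j} {zero , P0} _ → contradiction P0 ¬P0
                   ; {j} {suc i , _} eq → E.inverseˡ (Fin.suc-injective eq) })
              , (λ { {zero , P0} _ → contradiction P0 ¬P0
                   ; {suc i , _} refl → cong suc (E.inverseʳ refl) })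
  }
  where module E = Inverse e

-- Pigeonhole: if `f` missed a point `j`, punching `j` out of the codomain would inject
-- `Fin (suc n)` into `Fin n`.
injective⇒permutation : (f : Fin n → Fin n) → Injective _≡_ _≡_ f → Permutation′ n
injective⇒permutation {zero}  f inj = permutation f (λ ()) (λ ()) (λ ())
injective⇒permutation {suc n} f inj =
  permutation f (proj₁ ∘ preimage) (proj₂ ∘ preimage) (λ i → inj (proj₂ (preimage (f i))))
  where
  preimage : ∀ j → ∃ λ i → f i ≡ j
  preimage j with Fin.any? (λ i → f i Fin.≟ j)
  ... | yes found = found
  ... | no  none  = contradiction
    (Fin.injective⇒≤ {f = λ i → punchOut (missed i)}
      λ {i} {i′} eq → inj (Fin.punchOut-injective (missed i) (missed i′) eq))
    ℕ.1+n≰n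
    where
    missed : ∀ i → j ≢ f i
    missed i eq = none (i , sym eq)

-- Inversions and adjacent transpositions

⟨$⟩ʳ-injective : (w : Permutation′ n) → Injective _≡_ _≡_ (w ⟨$⟩ʳ_)
⟨$⟩ʳ-injective w eq = trans (sym (inverseˡ w)) (trans (cong (w ⟨$⟩ˡ_) eq) (inverseˡ w))

⟨$⟩ˡ-injective : (w : Permutation′ n) → Injective _≡_ _≡_ (w ⟨$⟩ˡ_)
⟨$⟩ˡ-injective w eq = trans (sym (inverseʳ w)) (trans (cong (w ⟨$⟩ʳ_) eq) (inverseʳ w))

≈⇒≗ˡ : (v w : Permutation′ n) → v ≈ w → ∀ x → v ⟨$⟩ˡ x ≡ w ⟨$⟩ˡ x
≈⇒≗ˡ v w v≈w x = ⟨$⟩ʳ-injective v (trans (inverseʳ v) (sym (trans (v≈w _) (inverseʳ w))))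

transpose-matchˡ : (i j : Fin n) → transpose i j ⟨$⟩ʳ i ≡ j
transpose-matchˡ i j rewrite dec-true (i Fin.≟ i) refl = refl

transpose-matchʳ : (i j : Fin n) → transpose i j ⟨$⟩ʳ j ≡ i
transpose-matchʳ i j with j Fin.≟ i
... | yes j≡i = j≡i
... | no  _ rewrite dec-true (j Fin.≟ j) refl = refl

transpose-mismatch : (i j : Fin n) {k : Fin n} → k ≢ i → k ≢ j → transpose i j ⟨$⟩ʳ k ≡ k
transpose-mismatch i j {k} k≢i k≢j
  rewrite dec-false (k Fin.≟ i) k≢i | dec-false (k Fin.≟ j) k≢j = refl

-- The inverse direction of `transpose i j` is by definition `transpose j i`; this identity
-- therefore makes `σ i` an involution.
transpose-symmetric : (i j k : Fin n) → transpose i j ⟨$⟩ʳ k ≡ transpose j i ⟨$⟩ʳ k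
transpose-symmetric i j k = by-cases (k Fin.≟ i) (k Fin.≟ j)
  where
  by-cases : Dec (k ≡ i) → Dec (k ≡ j) → transpose i j ⟨$⟩ʳ k ≡ transpose j i ⟨$⟩ʳ k
  by-cases (yes refl) _          = trans (transpose-matchˡ i j) (sym (transpose-matchʳ j i))
  by-cases (no _)     (yes refl) = trans (transpose-matchʳ i j) (sym (transpose-matchˡ j i))
  by-cases (no k≢i)   (no k≢j)   = trans (transpose-mismatch i j k≢i k≢j) (sym (transpose-mismatch j i k≢j k≢i))

σ-inject₁ : (i : Fin m) → σ i ⟨$⟩ʳ inject₁ i ≡ suc i
σ-inject₁ i = transpose-matchˡ (inject₁ i) (suc i)

σ-suc : (i : Fin m) → σ i ⟨$⟩ʳ suc i ≡ inject₁ i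
σ-suc i = transpose-matchʳ (inject₁ i) (suc i)

data Moved {m} (i : Fin m) : Fin (suc m) → Set where
  up    : Moved i (inject₁ i)
  down  : Moved i (suc i)
  fixed : ∀ {x} → x ≢ inject₁ i → x ≢ suc i → Moved i x

moved : (i : Fin m) (x : Fin (suc m)) → Moved i x
moved i x with x Fin.≟ inject₁ i | x Fin.≟ suc i
... | yes refl | _        = up
... | no _     | yes refl = down
... | no x≢i   | no x≢1+i = fixed x≢i x≢1+i

σ-fixed : (i : Fin m) {x : Fin (suc m)} → x ≢ inject₁ i → x ≢ suc i → σ i ⟨$⟩ʳ x ≡ x
σ-fixed i = transpose-mismatch (inject₁ i) (suc i)

σ-involutive : (i : Fin m) (x : Fin (suc m)) → σ i ⟨$⟩ʳ (σ i ⟨$⟩ʳ x) ≡ x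
σ-involutive i x =
  trans (cong (σ i ⟨$⟩ʳ_) (transpose-symmetric (inject₁ i) (suc i) x)) (inverseʳ (σ i))

inject₁<suc : (i : Fin m) → inject₁ i < suc i
inject₁<suc i = s≤s (ℕ.≤-reflexive (Fin.toℕ-inject₁ i))

-- No point lies strictly between the two points that `σ i` exchanges, so only their own order can
-- be reversed.
σ-mono-< : ∀ (i : Fin m) {x y} → x < y → ¬ (x ≡ inject₁ i × y ≡ suc i) →
           σ i ⟨$⟩ʳ x < σ i ⟨$⟩ʳ y
σ-mono-< i {x} {y} x<y ¬swap with moved i x | moved i y
... | up   | up   = contradiction x<y (ℕ.<-irrefl refl)
... | up   | down = contradiction (refl , refl) ¬swap
... | up   | fixed y≢i y≢s = subst₂ _<_ (sym (σ-inject₁ i)) (sym (σ-fixed i y≢i y≢s))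
  (ℕ.≤∧≢⇒< (subst (ℕ._< toℕ y) (Fin.toℕ-inject₁ i) x<y) (y≢s ∘ sym ∘ Fin.toℕ-injective))
... | down | up   = contradiction x<y (ℕ.<-asym (inject₁<suc i))
... | down | down = contradiction x<y (ℕ.<-irrefl refl)
... | down | fixed y≢i y≢s = subst₂ _<_ (sym (σ-suc i)) (sym (σ-fixed i y≢i y≢s))
  (ℕ.<-trans (inject₁<suc i) x<y)
... | fixed x≢i x≢s | up = subst₂ _<_ (sym (σ-fixed i x≢i x≢s)) (sym (σ-inject₁ i))
  (ℕ.<-trans x<y (inject₁<suc i))
... | fixed x≢i x≢s | down = subst₂ _<_ (sym (σ-fixed i x≢i x≢s)) (sym (σ-suc i))
  (ℕ.≤∧≢⇒< (subst (toℕ x ℕ.≤_) (sym (Fin.toℕ-inject₁ i)) (ℕ.≤-pred x<y)) (x≢i ∘ Fin.toℕ-injective))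
... | fixed x≢i x≢s | fixed y≢i y≢s =
  subst₂ _<_ (sym (σ-fixed i x≢i x≢s)) (sym (σ-fixed i y≢i y≢s)) x<y

-- Inversions are recorded by values, not by positions.
Inv : 𝔖 m → Rel (Fin (suc m)) 0ℓ
Inv w x y = x < y × w ⟨$⟩ˡ y < w ⟨$⟩ˡ x

Inv? : (w : 𝔖 m) → Decidable₂ (Inv w)
Inv? w x y = (x Fin.<? y) ×-dec (w ⟨$⟩ˡ y Fin.<? w ⟨$⟩ˡ x)

Inv-resp-≈ : (v w : 𝔖 m) → v ≈ w → Inv v ⇒ Inv w
Inv-resp-≈ v w v≈w (x<y , p) = x<y , subst₂ _<_ (≈⇒≗ˡ v w v≈w _) (≈⇒≗ˡ v w v≈w _) p

Inv-id : ∀ {x y} → ¬ Inv {m} id x y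
Inv-id (x<y , y<x) = ℕ.<-asym x<y y<x

Inv-trans : (w : 𝔖 m) → Transitive (Inv w)
Inv-trans w (x<y , p) (y<z , q) = ℕ.<-trans x<y y<z , ℕ.<-trans q p

inversions : 𝔖 m → ℕ
inversions w = sum λ x → count (Inv? w x)

inversions-mono : (v w : 𝔖 m) → Inv v ⇒ Inv w → inversions v ℕ.≤ inversions w
inversions-mono v w v⊆w =
  sum-mono-≤ λ x → sum-mono-≤ λ y → indicator-mono (Inv? v x y) (Inv? w x y) v⊆w

inversions-cong : (v w : 𝔖 m) → v ≈ w → inversions v ≡ inversions w
inversions-cong v w v≈w = ℕ.≤-antisym
  (inversions-mono v w (Inv-resp-≈ v w v≈w))
  (inversions-mono w v (Inv-resp-≈ w v (sym ∘ v≈w)))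

-- Right multiplication by σᵢ exchanges the entries `a` and `b` in the adjacent positions
-- `inject₁ i` and `suc i`.
module Step (v : 𝔖 m) (i : Fin m) where

  a b : Fin (suc m)
  a = v ⟨$⟩ʳ inject₁ i
  b = v ⟨$⟩ʳ suc i

  vσ : 𝔖 m
  vσ = σ i ∘ₚ v

  vσ-position : ∀ x → vσ ⟨$⟩ˡ x ≡ σ i ⟨$⟩ʳ (v ⟨$⟩ˡ x)
  vσ-position x = transpose-symmetric (suc i) (inject₁ i) (v ⟨$⟩ˡ x)

  v-position : ∀ x → v ⟨$⟩ˡ x ≡ σ i ⟨$⟩ʳ (vσ ⟨$⟩ˡ x)
  v-position x = sym (trans (cong (σ i ⟨$⟩ʳ_) (vσ-position x)) (σ-involutive i _))

  value : ∀ {x y} → v ⟨$⟩ˡ x ≡ y → x ≡ v ⟨$⟩ʳ y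
  value refl = sym (inverseʳ v)

  valueσ : ∀ {x y} → vσ ⟨$⟩ˡ x ≡ y → x ≡ v ⟨$⟩ʳ (σ i ⟨$⟩ʳ y)
  valueσ {x} eq = value (trans (v-position x) (cong (σ i ⟨$⟩ʳ_) eq))

  module _ (a<b : a < b) where

    Inv-ascent : Inv v ⇒ Inv vσ
    Inv-ascent {x} {y} (x<y , p) =
      -- The exceptional case would put `y` first and `x` second, so `y ≡ a` and `x ≡ b`, against
      -- `a < b`.
      x<y , subst₂ _<_ (sym (vσ-position y)) (sym (vσ-position x)) (σ-mono-< i p λ (yi , xs) →
        ℕ.<-asym x<y (subst₂ _<_ (sym (value yi)) (sym (value xs)) a<b))

    Inv-ascent⁻ : ∀ {x y} → Inv vσ x y → ¬ (x ≡ a × y ≡ b) → Inv v x y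
    Inv-ascent⁻ {x} {y} (x<y , p) ¬ab =
      x<y , subst₂ _<_ (sym (v-position y)) (sym (v-position x)) (σ-mono-< i p λ (yi , xs) →
        ¬ab ( trans (valueσ xs) (cong (v ⟨$⟩ʳ_) (σ-suc i))
            , trans (valueσ yi) (cong (v ⟨$⟩ʳ_) (σ-inject₁ i))))

    Inv-new : Inv vσ a b
    Inv-new = a<b , subst₂ _<_
      (sym (trans (vσ-position b) (trans (cong (σ i ⟨$⟩ʳ_) (inverseˡ v)) (σ-suc i))))
      (sym (trans (vσ-position a) (trans (cong (σ i ⟨$⟩ʳ_) (inverseˡ v)) (σ-inject₁ i))))
      (inject₁<suc i)

    Inv-old : ¬ Inv v a b
    Inv-old (_ , p) = ℕ.<-asym (inject₁<suc i) (subst₂ _<_ (inverseˡ v) (inverseˡ v) p)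

    inversions-ascent : inversions vσ ≡ suc (inversions v)
    inversions-ascent = sum-suc-at a
      (sum-suc-at b
        (trans (indicator-true (Inv? vσ a b) Inv-new)
               (cong suc (sym (indicator-false (Inv? v a b) Inv-old))))
        λ y y≢b → same a y (y≢b ∘ proj₂))
      λ x x≢a → sum-cong-≗ λ y → same x y (x≢a ∘ proj₁)
      where
      same : ∀ x y → ¬ (x ≡ a × y ≡ b) → indicator (Inv? vσ x y) ≡ indicator (Inv? v x y)
      same x y ¬ab = indicator-cong (Inv? vσ x y) (Inv? v x y) (λ p → Inv-ascent⁻ p ¬ab) Inv-ascent

-- A descent of `v` is an ascent of `σ i ∘ₚ v`, and exchanging twice restores `v`.
inversions-descent : (v : 𝔖 m) (i : Fin m) → Step.b v i < Step.a v i →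
                     inversions v ≡ suc (inversions (σ i ∘ₚ v))
inversions-descent v i b<a = trans
  (inversions-cong v (σ i ∘ₚ (σ i ∘ₚ v)) (λ x → cong (v ⟨$⟩ʳ_) (sym (σ-involutive i x))))
  (Step.inversions-ascent (σ i ∘ₚ v) i
    (subst₂ _<_ (cong (v ⟨$⟩ʳ_) (sym (σ-inject₁ i))) (cong (v ⟨$⟩ʳ_) (sym (σ-suc i))) b<a))

data Direction (v : 𝔖 m) (i : Fin m) : Set where
  ascent  : Step.a v i < Step.b v i → Direction v i
  descent : Step.b v i < Step.a v i → Direction v i

direction : (v : 𝔖 m) (i : Fin m) → Direction v i
direction v i with Fin.<-cmp (Step.a v i) (Step.b v i)
... | tri< a<b _ _ = ascent a<b
... | tri≈ _ a≡b _ = contradiction (cong toℕ (⟨$⟩ʳ-injective v a≡b)) (ℕ.<⇒≢ (inject₁<suc i))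
... | tri> _ _ b<a = descent b<a

inversions-step : (v : 𝔖 m) (i : Fin m) → inversions (σ i ∘ₚ v) ℕ.≤ suc (inversions v)
inversions-step v i with direction v i
... | ascent  a<b = ℕ.≤-reflexive (Step.inversions-ascent v i a<b)
... | descent b<a = ℕ.m≤n⇒m≤1+n (subst (inversions (σ i ∘ₚ v) ℕ.≤_) (sym (inversions-descent v i b<a)) (ℕ.n≤1+n _))

inversions-word : (v : 𝔖 m) (c : Word m) → inversions (product c ∘ₚ v) ℕ.≤ inversions v + length c
inversions-word v []      = ℕ.≤-reflexive (sym (ℕ.+-identityʳ _))
inversions-word v (i ∷ c) = begin
  inversions (product c ∘ₚ (σ i ∘ₚ v))  ≤⟨ inversions-word (σ i ∘ₚ v) c ⟩
  inversions (σ i ∘ₚ v) + length c      ≤⟨ ℕ.+-monoˡ-≤ (length c) (inversions-step v i) ⟩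
  suc (inversions v) + length c         ≡⟨ ℕ.+-suc (inversions v) (length c) ⟨
  inversions v + suc (length c)         ∎
  where open ℕ.≤-Reasoning

-- The weak order is inclusion of inversion sets

-- A letter adds at most one inversion, so the bound forces every letter of `c` to be an ascent, and
-- ascents keep all earlier inversions. A descent would lose an inversion that the remaining letters
-- are too few to make up for.
Inv-word : (v : 𝔖 m) (c : Word m) →
           inversions v + length c ℕ.≤ inversions (product c ∘ₚ v) → Inv v ⇒ Inv (product c ∘ₚ v)
Inv-word v []      _     p = p
Inv-word v (i ∷ c) bound p with direction v i
... | ascent a<b = Inv-word (σ i ∘ₚ v) c bound′ (Step.Inv-ascent v i a<b p)
  where
  bound′ : inversions (σ i ∘ₚ v) + length c ℕ.≤ inversions (product c ∘ₚ (σ i ∘ₚ v))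
  bound′ = subst (ℕ._≤ inversions (product c ∘ₚ (σ i ∘ₚ v)))
    (trans (ℕ.+-suc (inversions v) (length c))
           (cong (_+ length c) (sym (Step.inversions-ascent v i a<b))))
    bound
... | descent b<a = contradiction (ℕ.≤-trans bound (inversions-word (σ i ∘ₚ v) c)) (ℕ.<⇒≱
  (subst (λ k → inversions (σ i ∘ₚ v) + length c ℕ.< k + suc (length c))
         (sym (inversions-descent v i b<a))
         (ℕ.+-mono-≤ (ℕ.≤-refl {suc (inversions (σ i ∘ₚ v))}) (ℕ.n≤1+n (length c)))))

-- Induction upwards from `zero` gives `x ≤ f x`; induction downwards from the largest element gives
-- `f x ≤ x`.
increasing⇒id : (f : Fin (suc m) → Fin (suc m)) → (∀ i → f (inject₁ i) < f (suc i)) → ∀ x → f x ≡ x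
increasing⇒id {m} f inc x = Fin.toℕ-injective (ℕ.≤-antisym (upper x) (lower x))
  where
  lower : ∀ x → toℕ x ℕ.≤ toℕ (f x)
  lower = <-weakInduction _ z≤n λ i i≤fi →
    ℕ.≤-trans (s≤s (subst (ℕ._≤ toℕ (f (inject₁ i))) (Fin.toℕ-inject₁ i) i≤fi)) (inc i)

  upper : ∀ x → toℕ (f x) ℕ.≤ toℕ x
  upper = >-weakInduction _
    (subst (toℕ (f (fromℕ m)) ℕ.≤_) (sym (Fin.toℕ-fromℕ m)) (Fin.toℕ≤pred[n] (f (fromℕ m))))
    λ i fi≤i → subst (toℕ (f (inject₁ i)) ℕ.≤_) (sym (Fin.toℕ-inject₁ i))
      (ℕ.≤-pred (ℕ.≤-trans (inc i) fi≤i))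

-- Under these hypotheses w⁻¹ ∘ v increases at every step.
Inv-maximal : (v w : 𝔖 m) → Inv v ⇒ Inv w →
              (∀ i → Step.a v i < Step.b v i → ¬ Inv w (Step.a v i) (Step.b v i)) → v ≈ w
Inv-maximal v w v⊆w maximal x = trans (sym (inverseʳ w)) (cong (w ⟨$⟩ʳ_)
  (increasing⇒id (λ x → w ⟨$⟩ˡ (v ⟨$⟩ʳ x)) inc x))
  where
  inc : ∀ i → w ⟨$⟩ˡ Step.a v i < w ⟨$⟩ˡ Step.b v i
  inc i with direction v i
  -- The pair `(b , a)` is an inversion of `v`, hence of `w`, so `w` also places `a` before `b`.
  ... | descent b<a = proj₂ (v⊆w (b<a , subst₂ _<_ (sym (inverseˡ v)) (sym (inverseˡ v)) (inject₁<suc i)))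
  ... | ascent a<b with Fin.<-cmp (w ⟨$⟩ˡ Step.a v i) (w ⟨$⟩ˡ Step.b v i)
  ...   | tri< p _ _ = p
  ...   | tri≈ _ p _ = contradiction (cong toℕ (⟨$⟩ˡ-injective w p)) (ℕ.<⇒≢ a<b)
  ...   | tri> _ _ p = contradiction (a<b , p) (maximal i a<b)

Inv-antisym : (v w : 𝔖 m) → Inv v ⇒ Inv w → Inv w ⇒ Inv v → v ≈ w
Inv-antisym v w v⊆w w⊆v = Inv-maximal v w v⊆w λ i a<b p → Step.Inv-old v i a<b (w⊆v p)

-- Take ascents whose new pair lies in `Inv w` as long as there are any; `Inv-maximal` shows that
-- the climb can stop only at `w`. Each letter adds exactly one inversion, which fixes the length.
Inv⊆⇒word : (v w : 𝔖 m) → Inv v ⇒ Inv w →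
            ∃ λ c → product c ∘ₚ v ≈ w × inversions w ≡ inversions v + length c
Inv⊆⇒word {m} v w = climb (inversions w) v (ℕ.m≤m+n _ _)
  where
  -- `d` is fuel: it bounds the number of inversions still missing.
  climb : ∀ d (v : 𝔖 m) → inversions w ℕ.≤ d + inversions v → Inv v ⇒ Inv w →
          ∃ λ c → product c ∘ₚ v ≈ w × inversions w ≡ inversions v + length c
  climb d v bound v⊆w
    with Fin.any? (λ i → (Step.a v i Fin.<? Step.b v i) ×-dec (Inv? w (Step.a v i) (Step.b v i)))
  ... | no none = [] , v≈w , trans (sym (inversions-cong v w v≈w)) (sym (ℕ.+-identityʳ _))
    where
    v≈w : v ≈ w
    v≈w = Inv-maximal v w v⊆w λ i a<b p → none (i , a<b , p)
  ... | yes (i , a<b , p) = continue d bound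
    where
    open Step v i

    vσ⊆w : Inv vσ ⇒ Inv w
    vσ⊆w {x} {y} q with (x Fin.≟ a) ×-dec (y Fin.≟ b)
    ... | yes (refl , refl) = p
    ... | no ¬ab            = v⊆w (Inv-ascent⁻ a<b q ¬ab)

    continue : ∀ d → inversions w ℕ.≤ d + inversions v →
               ∃ λ c → product c ∘ₚ v ≈ w × inversions w ≡ inversions v + length c
    -- Without fuel `v` has at least as many inversions as `w`, yet `vσ` has one more and stays
    -- inside `Inv w`.
    continue zero    bound = contradiction
      (ℕ.≤-trans (inversions-mono vσ w vσ⊆w) bound)
      (ℕ.<⇒≱ (ℕ.≤-reflexive (sym (inversions-ascent a<b))))
    continue (suc d) bound =
      let c , eq , len = climb d vσ
            (subst (inversions w ℕ.≤_)
              (trans (sym (ℕ.+-suc d (inversions v))) (cong (d +_) (sym (inversions-ascent a<b)))) bound)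
            vσ⊆w
      in i ∷ c , eq , trans len (trans (cong (_+ length c) (inversions-ascent a<b))
                                       (sym (ℕ.+-suc (inversions v) (length c))))

-- Reduced words and inversion numbers

product-++ : (a c : Word m) → product (a ++ c) ≈ product c ∘ₚ product a
product-++ []      c x = refl
product-++ (i ∷ a) c x = cong (σ i ⟨$⟩ʳ_) (product-++ a c x)

-- The term `inversions id` is left unevaluated: it is a common offset that cancels whenever two
-- lengths are compared.
length-bound : (w : 𝔖 m) (a : Word m) → product a ≈ w → inversions w ℕ.≤ inversions {m} id + length a
length-bound w a eq = ℕ.≤-trans (ℕ.≤-reflexive (inversions-cong w (product a) (sym ∘ eq)))
  (inversions-word id a)

tight⇒reduced : (w : 𝔖 m) (a : Word m) → product a ≈ w →
                inversions w ≡ inversions {m} id + length a → IsReducedDecomposition a w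
tight⇒reduced {m} w a eq tight = eq , λ b eq′ →
  ℕ.+-cancelˡ-≤ (inversions {m} id) (length a) (length b)
    (subst (ℕ._≤ inversions {m} id + length b) tight (length-bound w b eq′))

-- Climbing from `id` to `w` yields a word that attains the bound, and `a` is no longer than that
-- word.
reduced⇒tight : (w : 𝔖 m) (a : Word m) → IsReducedDecomposition a w →
                inversions w ≡ inversions {m} id + length a
reduced⇒tight {m} w a (eq , minimal) with c , eq′ , tight ← Inv⊆⇒word id w (λ p → contradiction p Inv-id) =
  ℕ.≤-antisym (length-bound w a eq)
    (subst (inversions {m} id + length a ℕ.≤_) (sym tight) (ℕ.+-monoʳ-≤ (inversions {m} id) (minimal c eq′)))

-- Both the reduced word of `w` and its prefix attain the length bound, so the remaining letters `c`
-- supply exactly the difference and `Inv-word` applies.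
≤wk⇒Inv⊆ : (v w : 𝔖 m) → v ≤wk w → Inv v ⇒ Inv w
≤wk⇒Inv⊆ {m} v w (a , b , a-red , b-red , a⊑b) p with toView a⊑b
... | _++ᵛ_ {cs = a′} a≋a′ c with refl ← Pointwise-≡⇒≡ a≋a′ =
  Inv-resp-≈ (product c ∘ₚ product a) w eq
    (Inv-word (product a) c bound (Inv-resp-≈ v (product a) (sym ∘ proj₁ a-red) p))
  where
  eq : product c ∘ₚ product a ≈ w
  eq x = trans (sym (product-++ a c x)) (proj₁ b-red x)

  bound : inversions (product a) + length c ℕ.≤ inversions (product c ∘ₚ product a)
  bound = begin
    inversions (product a) + length c              ≡⟨ cong (_+ length c) (inversions-cong (product a) v (proj₁ a-red)) ⟩
    inversions v + length c                        ≡⟨ cong (_+ length c) (reduced⇒tight v a a-red) ⟩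
    inversions {m} id + length a + length c        ≡⟨ ℕ.+-assoc (inversions {m} id) (length a) (length c) ⟩
    inversions {m} id + (length a + length c)      ≡⟨ cong (inversions {m} id +_) (List.length-++ a) ⟨
    inversions {m} id + length (a ++ c)            ≡⟨ reduced⇒tight w (a ++ c) b-red ⟨
    inversions w                                   ≡⟨ inversions-cong w (product c ∘ₚ product a) (sym ∘ eq) ⟩
    inversions (product c ∘ₚ product a)            ∎
    where open ℕ.≤-Reasoning

-- Climb from `id` to `v` and then on to `w`: the lengths add up, so both words are reduced.
Inv⊆⇒≤wk : (v w : 𝔖 m) → Inv v ⇒ Inv w → v ≤wk w
Inv⊆⇒≤wk {m} v w v⊆w
  with a , a≈v , a-tight ← Inv⊆⇒word id v (λ p → contradiction p Inv-id)
     | c , c≈w , c-tight ← Inv⊆⇒word v w v⊆w =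
  a , a ++ c , tight⇒reduced v a a≈v a-tight , tight⇒reduced w (a ++ c) eq tight ,
  fromView (≡⇒Pointwise-≡ refl ++ᵛ c)
  where
  eq : product (a ++ c) ≈ w
  eq x = trans (product-++ a c x) (trans (a≈v (product c ⟨$⟩ʳ x)) (c≈w x))

  tight : inversions w ≡ inversions {m} id + length (a ++ c)
  tight = trans c-tight (trans (cong (_+ length c) a-tight)
    (trans (ℕ.+-assoc (inversions {m} id) (length a) (length c)) (cong (inversions {m} id +_) (sym (List.length-++ a)))))

-- Biclosed relations and the lattice structure

-- `cotransitive` is a positive form of transitivity of the complement inside `_<_`. Decidability is
-- carried along because complements and ranks are built by case distinction on membership.
record Biclosed (B : Rel (Fin n) 0ℓ) : Set where
  field
    member?      : Decidable₂ B
    ⊆<           : B ⇒ _<_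
    transitive   : Transitive B
    cotransitive : ∀ {x y z} → B x z → x < y → y < z → B x y ⊎ B y z

open Biclosed

Inv-biclosed : (w : 𝔖 m) → Biclosed (Inv w)
Inv-biclosed w = record
  { member?      = Inv? w
  ; ⊆<           = proj₁
  ; transitive   = Inv-trans w
  ; cotransitive = cotrans
  }
  where
  cotrans : ∀ {x y z} → Inv w x z → x < y → y < z → Inv w x y ⊎ Inv w y z
  cotrans {x} {y} (_ , p) x<y y<z with w ⟨$⟩ˡ y Fin.<? w ⟨$⟩ˡ x
  ... | yes q = inj₁ (x<y , q)
  ... | no ¬q = inj₂ (y<z , ℕ.<-≤-trans p (ℕ.≮⇒≥ ¬q))

-- For `Inv w` this is the inversion set of the one-line notation of `w` read backwards. It reverses
-- inclusion and so turns joins into meets.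
Complement : Rel (Fin n) 0ℓ → Rel (Fin n) 0ℓ
Complement B x y = x < y × ¬ B x y

Complement-biclosed : {B : Rel (Fin n) 0ℓ} → Biclosed B → Biclosed (Complement B)
Complement-biclosed {B = B} bc = record
  { member?      = λ x y → (x Fin.<? y) ×-dec ¬? (member? bc x y)
  ; ⊆<           = proj₁
  ; transitive   = λ (x<y , ¬p) (y<z , ¬q) → ℕ.<-trans x<y y<z , λ r → [ ¬p , ¬q ]′ (cotransitive bc r x<y y<z)
  ; cotransitive = cotrans
  }
  where
  cotrans : ∀ {x y z} → Complement B x z → x < y → y < z → Complement B x y ⊎ Complement B y z
  cotrans {x} {y} (_ , ¬r) x<y y<z with member? bc x y
  ... | yes p = inj₂ (y<z , λ q → ¬r (transitive bc p q))
  ... | no ¬p = inj₁ (x<y , ¬p)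

closure-least : {R S : Rel (Fin n) 0ℓ} → Transitive S → R ⇒ S → TransClosure R ⇒ S
closure-least trans R⊆S [ p ]   = R⊆S p
closure-least trans R⊆S (p ∷ q) = trans (R⊆S p) (closure-least trans R⊆S q)

module _ {R S : Rel (Fin n) 0ℓ} (bcR : Biclosed R) (bcS : Biclosed S) where

  ∪-⊆< : R ∪ S ⇒ _<_
  ∪-⊆< (inj₁ p) = ⊆< bcR p
  ∪-⊆< (inj₂ p) = ⊆< bcS p

  ∪? : Decidable₂ (R ∪ S)
  ∪? x y = (member? bcR x y) ⊎-dec (member? bcS x y)

  -- Every step strictly increases, so a search over the first step leaves a chain that starts at a
  -- larger element.
  closure? : ∀ {x} → Acc _>_ x → ∀ y → Dec (TransClosure (R ∪ S) x y)
  closure? {x} (acc rec) y with ∪? x y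
  ... | yes p = yes [ p ]
  ... | no ¬p = map′ (λ (_ , p , q) → p ∷ q) unfold (Fin.any? step?)
    where
    unfold : TransClosure (R ∪ S) x y → ∃ λ z → (R ∪ S) x z × TransClosure (R ∪ S) z y
    unfold [ p ]   = contradiction p ¬p
    unfold (p ∷ q) = _ , p , q

    step? : ∀ z → Dec ((R ∪ S) x z × TransClosure (R ∪ S) z y)
    step? z with ∪? x z
    ... | yes p = map′ (p ,_) proj₂ (closure? (rec (∪-⊆< p)) y)
    ... | no ¬p = no (¬p ∘ proj₁)

  ∪-cotransitive : ∀ {x y z} → (R ∪ S) x z → x < y → y < z → (R ∪ S) x y ⊎ (R ∪ S) y z
  ∪-cotransitive (inj₁ p) x<y y<z = map-⊎ inj₁ inj₁ (cotransitive bcR p x<y y<z)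
  ∪-cotransitive (inj₂ p) x<y y<z = map-⊎ inj₂ inj₂ (cotransitive bcS p x<y y<z)

  -- Either `y` is a vertex of the chain and splits it, or `y` lies strictly between two consecutive
  -- vertices; then cotransitivity of that single step connects `y` to one side.
  closure-cotransitive : ∀ {x y z} → TransClosure (R ∪ S) x z → x < y → y < z →
                         TransClosure (R ∪ S) x y ⊎ TransClosure (R ∪ S) y z
  closure-cotransitive [ p ] x<y y<z = map-⊎ [_] [_] (∪-cotransitive p x<y y<z)
  closure-cotransitive {y = y} (_∷_ {y = u} p q) x<y y<z with Fin.<-cmp u y
  ... | tri≈ _ refl _ = inj₁ [ p ]
  ... | tri< u<y _ _  = map-⊎ (p ∷_) idᶠ (closure-cotransitive q u<y y<z)
  ... | tri> _ _ y<u  = map-⊎ [_] (_∷ q) (∪-cotransitive p x<y y<u)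

  closure-biclosed : Biclosed (TransClosure (R ∪ S))
  closure-biclosed = record
    { member?      = λ x y → closure? (>-wellFounded x) y
    ; ⊆<           = closure-least ℕ.<-trans ∪-⊆<
    ; transitive   = Plus._++_
    ; cotransitive = closure-cotransitive
    }

-- From biclosed relations to permutations

module Realise {B : Rel (Fin (suc m)) 0ℓ} (bc : Biclosed B) where

  infix 4 _≺_ _≺?_

  -- The order in which a permutation with inversion set B lists the values.
  _≺_ : Rel (Fin (suc m)) 0ℓ
  x ≺ y = Complement B x y ⊎ B y x

  _≺?_ : Decidable₂ _≺_
  x ≺? y = (member? (Complement-biclosed bc) x y) ⊎-dec (member? bc y x)

  ≺-irrefl : ∀ {x} → ¬ x ≺ x
  ≺-irrefl (inj₁ (x<x , _)) = ℕ.<-irrefl refl x<x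
  ≺-irrefl (inj₂ p)         = ℕ.<-irrefl refl (⊆< bc p)

  -- Two comparisons of the same kind compose by transitivity of `B` or of its complement. In the
  -- mixed cases the natural order of `x` and `z` decides: transitivity of `B` settles `x < z`,
  -- cotransitivity settles `z < x`.
  ≺-trans : Transitive _≺_
  ≺-trans (inj₁ p) (inj₁ q) = inj₁ (transitive (Complement-biclosed bc) p q)
  ≺-trans (inj₂ p) (inj₂ q) = inj₂ (transitive bc q p)
  ≺-trans {x} {y} {z} (inj₁ (x<y , ¬p)) (inj₂ q) with Fin.<-cmp x z
  ... | tri< x<z _ _  = inj₁ (x<z , λ r → ¬p (transitive bc r q))
  ... | tri≈ _ refl _ = contradiction q ¬p
  ... | tri> _ _ z<x with cotransitive bc q z<x x<y
  ...   | inj₁ r = inj₂ r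
  ...   | inj₂ r = contradiction r ¬p
  ≺-trans {x} {y} {z} (inj₂ p) (inj₁ (y<z , ¬q)) with Fin.<-cmp x z
  ... | tri< x<z _ _  = inj₁ (x<z , λ r → ¬q (transitive bc p r))
  ... | tri≈ _ refl _ = contradiction p ¬q
  ... | tri> _ _ z<x with cotransitive bc p y<z z<x
  ...   | inj₁ r = contradiction r ¬q
  ...   | inj₂ r = inj₂ r

  data Comparison (x y : Fin (suc m)) : Set where
    before : x ≺ y → Comparison x y
    equal  : x ≡ y → Comparison x y
    after  : y ≺ x → Comparison x y

  compare : ∀ x y → Comparison x y
  compare x y with Fin.<-cmp x y
  ... | tri≈ _ x≡y _ = equal x≡y
  ... | tri< x<y _ _ with member? bc x y
  ...   | yes p = after (inj₂ p)
  ...   | no ¬p = before (inj₁ (x<y , ¬p))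
  compare x y | tri> _ _ y<x with member? bc y x
  ...   | yes p = before (inj₂ p)
  ...   | no ¬p = after (inj₁ (y<x , ¬p))

  rank : Fin (suc m) → Fin (suc m)
  -- The count stays below `suc m` because `x` does not precede itself.
  rank x = fromℕ< (count<n (_≺? x) x ≺-irrefl)

  rank-mono : ∀ {x y} → x ≺ y → rank x < rank y
  rank-mono {x} {y} x≺y = subst₂ ℕ._<_ (sym (Fin.toℕ-fromℕ< _)) (sym (Fin.toℕ-fromℕ< _))
    (count-mono-< (_≺? x) (_≺? y) (λ _ z≺x → ≺-trans z≺x x≺y) x ≺-irrefl x≺y)

  rank-injective : Injective _≡_ _≡_ rank
  rank-injective {x} {y} eq with compare x y
  ... | before x≺y = contradiction (cong toℕ eq) (ℕ.<⇒≢ (rank-mono x≺y))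
  ... | equal x≡y  = x≡y
  ... | after y≺x  = contradiction (cong toℕ (sym eq)) (ℕ.<⇒≢ (rank-mono y≺x))

  abstract
    realise : 𝔖 m
    -- `rank` sends values to positions, which is the direction of `_⟨$⟩ˡ_`; hence `flip`.
    realise = flip (injective⇒permutation rank rank-injective)

    Inv-realise⁺ : B ⇒ Inv realise
    Inv-realise⁺ p = ⊆< bc p , rank-mono (inj₂ p)

    Inv-realise⁻ : Inv realise ⇒ B
    Inv-realise⁻ {x} {y} (x<y , r) with member? bc x y
    ... | yes p = p
    ... | no ¬p = contradiction r (ℕ.<-asym (rank-mono (inj₁ (x<y , ¬p))))

open Realise using (realise; Inv-realise⁺; Inv-realise⁻)

-- Joins and meets of permutations

module _ (u v : 𝔖 m) where

  private
    join-biclosed = closure-biclosed (Inv-biclosed u) (Inv-biclosed v)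
    -- De Morgan: the complement of the closed union of the complements.
    meet-biclosed = Complement-biclosed
      (closure-biclosed (Complement-biclosed (Inv-biclosed u)) (Complement-biclosed (Inv-biclosed v)))

  join meet : 𝔖 m
  join = realise join-biclosed
  meet = realise meet-biclosed

  join-upperˡ : Inv u ⇒ Inv join
  join-upperˡ p = Inv-realise⁺ join-biclosed [ inj₁ p ]

  join-upperʳ : Inv v ⇒ Inv join
  join-upperʳ p = Inv-realise⁺ join-biclosed [ inj₂ p ]

  join-least : (w : 𝔖 m) → Inv u ⇒ Inv w → Inv v ⇒ Inv w → Inv join ⇒ Inv w
  join-least w u⊆w v⊆w p = closure-least (Inv-trans w) [ u⊆w , v⊆w ]′ (Inv-realise⁻ join-biclosed p)

  meet-lowerˡ : Inv meet ⇒ Inv u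
  meet-lowerˡ p with Inv-realise⁻ meet-biclosed p
  ... | x<y , ¬q with Inv? u _ _
  ...   | yes r = r
  ...   | no ¬r = contradiction [ inj₁ (x<y , ¬r) ] ¬q

  meet-lowerʳ : Inv meet ⇒ Inv v
  meet-lowerʳ p with Inv-realise⁻ meet-biclosed p
  ... | x<y , ¬q with Inv? v _ _
  ...   | yes r = r
  ...   | no ¬r = contradiction [ inj₂ (x<y , ¬r) ] ¬q

  -- The complement of `Inv w` is transitive and contains both other complements, hence also the
  -- closure of their union.
  meet-greatest : (w : 𝔖 m) → Inv w ⇒ Inv u → Inv w ⇒ Inv v → Inv w ⇒ Inv meet
  meet-greatest w w⊆u w⊆v p = Inv-realise⁺ meet-biclosed (proj₁ p , λ q → proj₂
    (closure-least (transitive (Complement-biclosed (Inv-biclosed w)))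
      [ (λ (x<y , ¬r) → x<y , ¬r ∘ w⊆u) , (λ (x<y , ¬r) → x<y , ¬r ∘ w⊆v) ]′ q) p)

-- The weak order and its intervals as lattices

permutations : ℕ → Setoid 0ℓ 0ℓ
permutations n = record
  { Carrier       = Permutation′ n
  ; _≈_           = _≈_
  ; isEquivalence = record
    { refl = λ _ → refl ; sym = λ p x → sym (p x) ; trans = λ p q x → trans (p x) (q x) }
  }

≤wk-trans : (u v w : 𝔖 m) → u ≤wk v → v ≤wk w → u ≤wk w
≤wk-trans u v w u≤v v≤w = Inv⊆⇒≤wk u w (≤wk⇒Inv⊆ v w v≤w ∘ ≤wk⇒Inv⊆ u v u≤v)

≤wk-isPartialOrder : IsPartialOrder (_≈_ {suc m} {suc m}) _≤wk_
≤wk-isPartialOrder {m} = record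
  { isPreorder = record
    { isEquivalence = Setoid.isEquivalence (permutations (suc m))
    ; reflexive = λ {v} {w} v≈w → Inv⊆⇒≤wk v w (Inv-resp-≈ v w v≈w)
    ; trans = λ {u} {v} {w} → ≤wk-trans u v w
    }
  ; antisym = λ {v} {w} v≤w w≤v → Inv-antisym v w (≤wk⇒Inv⊆ v w v≤w) (≤wk⇒Inv⊆ w v w≤v)
  }

module _ (x y : 𝔖 m) where

  x≤join : x ≤wk join x y
  x≤join = Inv⊆⇒≤wk x (join x y) (join-upperˡ x y)

  y≤join : y ≤wk join x y
  y≤join = Inv⊆⇒≤wk y (join x y) (join-upperʳ x y)

  join≤ : ∀ z → x ≤wk z → y ≤wk z → join x y ≤wk z
  join≤ z x≤z y≤z =
    Inv⊆⇒≤wk (join x y) z (join-least x y z (≤wk⇒Inv⊆ x z x≤z) (≤wk⇒Inv⊆ y z y≤z))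

  meet≤x : meet x y ≤wk x
  meet≤x = Inv⊆⇒≤wk (meet x y) x (meet-lowerˡ x y)

  meet≤y : meet x y ≤wk y
  meet≤y = Inv⊆⇒≤wk (meet x y) y (meet-lowerʳ x y)

  ≤meet : ∀ z → z ≤wk x → z ≤wk y → z ≤wk meet x y
  ≤meet z z≤x z≤y =
    Inv⊆⇒≤wk z (meet x y) (meet-greatest x y z (≤wk⇒Inv⊆ z x z≤x) (≤wk⇒Inv⊆ z y z≤y))

-- Joins and meets are taken in the whole group. They stay in the interval because `w` is an upper
-- bound and `v` a lower bound of all its elements.
intervalIsLattice : (v w : 𝔖 m) → IntervalIsLattice v w
intervalIsLattice {m} v w = _∨_ , _∧_ , record
  { isPartialOrder = On.isPartialOrder proj₁ ≤wk-isPartialOrder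
  ; supremum = λ (x , _) (y , _) → x≤join x y , y≤join x y , λ (z , _) → join≤ x y z
  ; infimum = λ (x , _) (y , _) → meet≤x x y , meet≤y x y , λ (z , _) → ≤meet x y z
  }
  where
  _∨_ _∧_ : ∃ (_∈ [ v , w ]wk) → ∃ (_∈ [ v , w ]wk) → ∃ (_∈ [ v , w ]wk)
  (x , v≤x , x≤w) ∨ (y , _ , y≤w) = join x y , ≤wk-trans v x (join x y) v≤x (x≤join x y) , join≤ x y w x≤w y≤w
  (x , v≤x , x≤w) ∧ (y , v≤y , _) = meet x y , ≤meet x y v v≤x v≤y , ≤wk-trans (meet x y) x w (meet≤x x y) x≤w

-- Counting the intervals

remove-cong : (i : Fin (suc n)) (π ρ : Permutation′ (suc n)) → π ≈ ρ → remove i π ≈ remove i ρ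
remove-cong i π ρ π≈ρ j = Fin.punchIn-injective (π ⟨$⟩ʳ i) _ _ (begin
  punchIn (π ⟨$⟩ʳ i) (remove i π ⟨$⟩ʳ j)  ≡⟨ punchIn-permute π i j ⟨
  π ⟨$⟩ʳ punchIn i j                      ≡⟨ π≈ρ (punchIn i j) ⟩
  ρ ⟨$⟩ʳ punchIn i j                      ≡⟨ punchIn-permute ρ i j ⟩
  punchIn (ρ ⟨$⟩ʳ i) (remove i ρ ⟨$⟩ʳ j)  ≡⟨ cong (λ k → punchIn k (remove i ρ ⟨$⟩ʳ j)) (π≈ρ i) ⟨
  punchIn (π ⟨$⟩ʳ i) (remove i ρ ⟨$⟩ʳ j)  ∎)
  where open ≡-Reasoning

insert-zero-cong : {i j : Fin (suc n)} (π ρ : Permutation′ n) → i ≡ j → π ≈ ρ → insert zero i π ≈ insert zero j ρ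
insert-zero-cong         π ρ refl π≈ρ zero    = refl
insert-zero-cong {i = i} π ρ refl π≈ρ (suc k) = trans (insert-punchIn zero i π k)
  (trans (cong (punchIn i) (π≈ρ k)) (sym (insert-punchIn zero i ρ k)))

abstract
  -- A permutation of `suc n` points is encoded by the image of `zero` and the permutation of `n`
  -- points left after removing `zero`, which gives the factor `suc n`.
  permutations-cardinality : ∀ n → HasCardinality (permutations n) (n !)
  permutations-cardinality zero = record
    { to = λ _ → zero ; from = λ _ → id ; to-cong = λ _ → refl ; from-cong = λ _ ()
    ; inverse = (λ { {zero} _ → refl }) , λ _ () }
  permutations-cardinality (suc n) = record
    { to        = to
    ; from      = from
    ; to-cong   = λ {π} {ρ} → to-cong π ρ
    ; from-cong = λ { refl _ → refl }
    ; inverse   = (λ {x} {π} π≈ → trans (to-cong π (from x) π≈) (to-from x))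
                , λ { {π} refl → from-to π }
    }
    where
    module Enum = Inverse (permutations-cardinality n)

    to : Permutation′ (suc n) → Fin (suc n !)
    to π = combine (π ⟨$⟩ʳ zero) (Enum.to (remove zero π))

    head : Fin (suc n !) → Fin (suc n)
    head x = proj₁ (remQuot {suc n} (n !) x)

    rest : Fin (suc n !) → Fin (n !)
    rest x = proj₂ (remQuot {suc n} (n !) x)

    from : Fin (suc n !) → Permutation′ (suc n)
    from x = insert zero (head x) (Enum.from (rest x))

    to-cong : ∀ π ρ → π ≈ ρ → to π ≡ to ρ
    to-cong π ρ π≈ρ = cong₂ combine (π≈ρ zero) (Enum.to-cong (remove-cong zero π ρ π≈ρ))

    to-from : ∀ x → to (from x) ≡ x
    to-from x = trans
      (cong (combine (head x)) (Enum.inverseˡ {rest x} (remove-insert zero (head x) (Enum.from (rest x)))))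
      (Fin.combine-remQuot {suc n} (n !) x)

    from-to : ∀ π → from (to π) ≈ π
    from-to π x = trans
      (insert-zero-cong (Enum.from (rest (to π))) (remove zero π)
        (cong proj₁ split) (Enum.inverseʳ {remove zero π} (cong proj₂ split)) x)
      (insert-remove zero π x)
      where
      split : remQuot {suc n} (n !) (to π) ≡ (π ⟨$⟩ʳ zero , Enum.to (remove zero π))
      split = Fin.remQuot-combine (π ⟨$⟩ʳ zero) (Enum.to (remove zero π))

-- Exactly one of `x` and `ι x` satisfies `P`. Reindexing by `ι` preserves the count, so twice the
-- count is `n` and the division is exact.
count-half : {P : Pred (Fin n) 0ℓ} (P? : Decidable P) (ι : Permutation′ n) →
             (∀ x → P x → ¬ P (ι ⟨$⟩ʳ x)) → (∀ x → ¬ P x → P (ι ⟨$⟩ʳ x)) →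
             count P? ≡ n / 2
count-half {n} P? ι P⇒¬Pι ¬P⇒Pι = trans (sym (m*n/n≡m (count P?) 2)) (cong (_/ 2) (begin
  count P? * 2                                            ≡⟨ ℕ.*-comm (count P?) 2 ⟩
  count P? + (count P? + 0)                               ≡⟨ cong (count P? +_) (ℕ.+-identityʳ _) ⟩
  count P? + count P?                                     ≡⟨ cong (count P? +_) (sum-permute (indicator ∘ P?) ι) ⟩
  count P? + count (λ x → P? (ι ⟨$⟩ʳ x))                  ≡⟨ ∑-distrib-+ (indicator ∘ P?) (indicator ∘ P? ∘ (ι ⟨$⟩ʳ_)) ⟨
  sum (λ x → indicator (P? x) + indicator (P? (ι ⟨$⟩ʳ x))) ≡⟨ sum-cong-≗ toggles ⟩
  sum {n} (λ _ → 1)                                       ≡⟨ sum-const-1 n ⟩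
  n                                                       ∎))
  where
  open ≡-Reasoning

  toggles : ∀ x → indicator (P? x) + indicator (P? (ι ⟨$⟩ʳ x)) ≡ 1
  toggles x with P? x
  ... | yes p = cong suc (indicator-false (P? (ι ⟨$⟩ʳ x)) (P⇒¬Pι x p))
  ... | no ¬p = indicator-true (P? (ι ⟨$⟩ʳ x)) (¬P⇒Pι x ¬p)

module _ (k : Fin m) where

  Inverts : 𝔖 m → Set
  Inverts w = Inv w (inject₁ k) (suc k)

  σ≤⇒Inverts : (w : 𝔖 m) → σ k ≤wk w → Inverts w
  σ≤⇒Inverts w σ≤w = ≤wk⇒Inv⊆ (σ k) w σ≤w (Step.Inv-new id k (inject₁<suc k))

  -- As one ascent from `id`, `σ k` has `(inject₁ k , suc k)` as its only inversion.
  Inverts⇒σ≤ : (w : 𝔖 m) → Inverts w → σ k ≤wk w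
  Inverts⇒σ≤ w p = Inv⊆⇒≤wk (σ k) w σ⊆w
    where
    σ⊆w : Inv (σ k) ⇒ Inv w
    σ⊆w {x} {y} q with (x Fin.≟ inject₁ k) ×-dec (y Fin.≟ suc k)
    ... | yes (refl , refl) = p
    ... | no ¬ab            = contradiction (Step.Inv-ascent⁻ id k (inject₁<suc k) q ¬ab) Inv-id

  -- Here `σ k` multiplies from the left and exchanges two values, unlike in `Step`, where it
  -- exchanges two positions.
  swap-position : (w : 𝔖 m) (x : Fin (suc m)) → (w ∘ₚ σ k) ⟨$⟩ˡ x ≡ w ⟨$⟩ˡ (σ k ⟨$⟩ʳ x)
  swap-position w x = cong (w ⟨$⟩ˡ_) (transpose-symmetric (suc k) (inject₁ k) x)

  swap-suc : (w : 𝔖 m) → (w ∘ₚ σ k) ⟨$⟩ˡ suc k ≡ w ⟨$⟩ˡ inject₁ k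
  swap-suc w = trans (swap-position w (suc k)) (cong (w ⟨$⟩ˡ_) (σ-suc k))

  swap-inject₁ : (w : 𝔖 m) → (w ∘ₚ σ k) ⟨$⟩ˡ inject₁ k ≡ w ⟨$⟩ˡ suc k
  swap-inject₁ w = trans (swap-position w (inject₁ k)) (cong (w ⟨$⟩ˡ_) (σ-inject₁ k))

  Inverts-swap⁻ : (w : 𝔖 m) → Inverts w → ¬ Inverts (w ∘ₚ σ k)
  Inverts-swap⁻ w (_ , p) (_ , q) = ℕ.<-asym p (subst₂ _<_ (swap-suc w) (swap-inject₁ w) q)

  Inverts-swap⁺ : (w : 𝔖 m) → ¬ Inverts w → Inverts (w ∘ₚ σ k)
  Inverts-swap⁺ w ¬p = inject₁<suc k , subst₂ _<_ (sym (swap-suc w)) (sym (swap-inject₁ w)) later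
    where
    later : w ⟨$⟩ˡ inject₁ k < w ⟨$⟩ˡ suc k
    later with Fin.<-cmp (w ⟨$⟩ˡ inject₁ k) (w ⟨$⟩ˡ suc k)
    ... | tri< lt _ _ = lt
    ... | tri≈ _ eq _ = contradiction (cong toℕ (⟨$⟩ˡ-injective w eq)) (ℕ.<⇒≢ (inject₁<suc k))
    ... | tri> _ _ gt = contradiction (inject₁<suc k , gt) ¬p

  private
    module Enum = Inverse (permutations-cardinality (suc m))
    N = suc m !

    InvertsAt : Pred (Fin N) 0ℓ
    InvertsAt x = Inverts (Enum.from x)

    InvertsAt? : Decidable InvertsAt
    InvertsAt? x = Inv? (Enum.from x) (inject₁ k) (suc k)

    f : Fin N → Fin N
    -- Left multiplication by `σ k`, carried over to indices, where it is an involution up to `_≡_`.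
    f x = Enum.to (Enum.from x ∘ₚ σ k)

    from-f : ∀ x → Enum.from (f x) ≈ Enum.from x ∘ₚ σ k
    from-f x = Enum.inverseʳ {Enum.from x ∘ₚ σ k} refl

    f-involutive : ∀ x → f (f x) ≡ x
    f-involutive x = Enum.inverseˡ {x} λ i →
      trans (cong (σ k ⟨$⟩ʳ_) (from-f x i)) (σ-involutive k _)

    ι : Permutation′ N
    ι = permutation f f f-involutive f-involutive

  count-Inverts : count InvertsAt? ≡ N / 2
  count-Inverts = count-half InvertsAt? ι
    (λ x p q → Inverts-swap⁻ (Enum.from x) p (Inv-resp-≈ (Enum.from (f x)) (Enum.from x ∘ₚ σ k) (from-f x) q))
    (λ x ¬p → Inv-resp-≈ (Enum.from x ∘ₚ σ k) (Enum.from (f x)) (sym ∘ from-f x) (Inverts-swap⁺ (Enum.from x) ¬p))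

  private
    open LatticeInterval

    -- Each top lies in its own interval, so equal intervals have tops that lie below each other.
    elements⇒top : (I J : LatticeInterval (σ k)) → elements I ≐ elements J → top I ≈ top J
    elements⇒top I J (I⊆J , J⊆I) = Inv-antisym (top I) (top J)
      (≤wk⇒Inv⊆ (top I) (top J) (proj₂ (I⊆J {top I} (v≤top I , Inv⊆⇒≤wk (top I) (top I) idᶠ))))
      (≤wk⇒Inv⊆ (top J) (top I) (proj₂ (J⊆I {top J} (v≤top J , Inv⊆⇒≤wk (top J) (top J) idᶠ))))

    ≤wk-respʳ-≈ : (u v w : 𝔖 m) → v ≈ w → u ≤wk v → u ≤wk w
    ≤wk-respʳ-≈ u v w v≈w u≤v = ≤wk-trans u v w u≤v (Inv⊆⇒≤wk v w (Inv-resp-≈ v w v≈w))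

    top⇒elements : (I J : LatticeInterval (σ k)) → top I ≈ top J → elements I ≐ elements J
    top⇒elements I J eq =
      (λ {u} (σ≤u , u≤I) → σ≤u , ≤wk-respʳ-≈ u (top I) (top J) eq u≤I) ,
      (λ {u} (σ≤u , u≤J) → σ≤u , ≤wk-respʳ-≈ u (top J) (top I) (sym ∘ eq) u≤J)

    interval : (w : 𝔖 m) → Inverts w → LatticeInterval (σ k)
    interval w p = record { top = w ; v≤top = Inverts⇒σ≤ w p ; isLattice = intervalIsLattice (σ k) w }

    from-to : (w : 𝔖 m) → Enum.from (Enum.to w) ≈ w
    from-to w = Enum.inverseʳ {w} refl

  -- An interval corresponds to the index of its top. Every index in `InvertsAt` occurs, because all
  -- intervals are lattices.
  intervals↔Inverts : Inverse (latticeIntervals (σ k)) (On.setoid (setoid (Fin N)) (proj₁ {B = InvertsAt}))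
  intervals↔Inverts = record
    { to        = to
    ; from      = from
    ; to-cong   = λ {I} {J} I≐J → Enum.to-cong (elements⇒top I J I≐J)
    ; from-cong = λ { refl → ≐-refl }
    ; inverse   = (λ {y} {I} I≐ → Enum.inverseˡ {proj₁ y} (elements⇒top I (from y) I≐))
                , (λ { {I} {x , p} eq → top⇒elements (from (x , p)) I (Enum.inverseʳ {top I} eq) })
    }
    where
    to : LatticeInterval (σ k) → ∃ InvertsAt
    to I = Enum.to (top I) ,
      Inv-resp-≈ (top I) (Enum.from (Enum.to (top I))) (sym ∘ from-to (top I))
        (σ≤⇒Inverts (top I) (v≤top I))

    from : ∃ InvertsAt → LatticeInterval (σ k)
    from (x , p) = interval (Enum.from x) p

  intervals-cardinality : HasCardinality (latticeIntervals (σ k)) (N / 2)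
  intervals-cardinality = subst (HasCardinality (latticeIntervals (σ k))) count-Inverts
    (Composition.inverse intervals↔Inverts (count-enumerates InvertsAt?))

proposition5p7 : (m : ℕ) (k : Fin m) →
    HasCardinality (latticeIntervals (σ k)) ((suc m) ! / 2)
proposition5p7 m k = intervals-cardinality k
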